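{- For any constant $\epsilon>0$, there exists a randomized $(\epsilon n/\log n)$-approximation algorithm for XOS maximization in the value oracle model that runs in $O(n^{1/\epsilon+1}\log n)$ time. That is, for every XOS function $f\colon 2^V\to\mathbb{R}$ on a finite ground set $V$ of size $n\ge 2$ (with $\epsilon n/\log n\ge 1$) given by a value oracle, the algorithm returns a random set $\tilde X\subseteq V$ with $\mathbb{E}[f(\tilde X)]\ge \frac{\log n}{\epsilon n}\max_{X\subseteq V}f(X)$.
   Context: $\log$ is the natural logarithm. A set function $f\colon 2^V\to\mathbb{R}$ is additive if $f(X)=\sum_{v\in X}f(\{v\})$ for all $X\subseteq V$. It is XOS if there are finitely many additive functions $f_1,\dots,f_k\colon 2^V\to\mathbb{R}$ (values may be negative) such that $f(X)=\max_{i\in[k]}f_i(X)$ for all $X\subseteq V$; $f$ need not be monotone. XOS maximization: given an XOS function $f$ on $V$, $n=|V|$, accessible only through a value oracle (a query $X\subseteq V$ returns $f(X)$; the additive functions are not given), find $X\subseteq V$ maximizing $f(X)$. For $\alpha\ge1$, a randomized algorithm is an $\alpha$-approximation algorithm if the expected function value of its output is at least $\frac1\alpha\max_{X\subseteq V}f(X)$. Running time is measured by the number of value oracle calls, which asymptotically dominates the remaining computation. -}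

module Defs where

open import Algebra.Bundles using (CommutativeRing; Semiring)
open import Algebra.Structures using (IsCommutativeRing)
import Algebra.Definitions.RawSemiring as RawSemiringDefs
open import Data.Bool.Base using (if_then_else_)
open import Data.Fin.Base using (Fin; toℕ)
open import Data.Fin.Subset using (Subset; ⁅_⁆)
open import Data.Fin.Subset.Properties using (_∈?_)
open import Data.Nat.Base as ℕ using (ℕ; suc; _!)
open import Data.Product.Base using (Σ-syntax; ∃-syntax; _×_)
import Data.Vec.Functional as Vector
open import Level using (0ℓ)
open import Relation.Binary.Core using (Rel)
open import Relation.Binary.Structures using (IsTotalOrder)
import Relation.Binary.Construct.NonStrictToStrict as ToStrict
open import Relation.Binary.PropositionalEquality.Core using (_≡_; _≢_)
open import Relation.Nullary.Decidable.Core using (does)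

IsUpperBound : {A : Set} → Rel A 0ℓ → (A → Set) → A → Set
IsUpperBound _≤_ S u = ∀ x → S x → x ≤ u

-- The standard library has no real numbers.  They are axiomatised here as a
-- Dedekind-complete totally ordered field, a structure which is unique up to
-- unique isomorphism.  As is usual classically, _⁻¹ and sup are total
-- functions about which nothing is assumed outside their proper domains (zero,
-- respectively empty or unbounded sets).
record RealNumbers : Set₁ where
  infix  8 _⁻¹
  infixl 7 _*_
  infixl 6 _+_
  infix  4 _≤_
  field
    ℝ                 : Set
    _+_ _*_           : ℝ → ℝ → ℝ
    -_ _⁻¹            : ℝ → ℝ
    0# 1#             : ℝ
    _≤_               : Rel ℝ 0ℓ
    sup               : (ℝ → Set) → ℝ
    isCommutativeRing : IsCommutativeRing _≡_ _+_ _*_ -_ 0# 1#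
    0≢1               : 0# ≢ 1#
    ⁻¹-inverse        : ∀ x → x ≢ 0# → x * x ⁻¹ ≡ 1#
    isTotalOrder      : IsTotalOrder _≡_ _≤_
    +-monoʳ-≤         : ∀ x {y z} → y ≤ z → x + y ≤ x + z
    *-nonneg          : ∀ {x y} → 0# ≤ x → 0# ≤ y → 0# ≤ x * y
    sup-upper         : ∀ S → (∃[ x ] S x) → (∃[ u ] IsUpperBound _≤_ S u) →
                        IsUpperBound _≤_ S (sup S)
    sup-least         : ∀ S → (∃[ x ] S x) → ∀ u → IsUpperBound _≤_ S u →
                        sup S ≤ u

module RealAnalysis (R : RealNumbers) where
  open RealNumbers R public

  commutativeRing : CommutativeRing 0ℓ 0ℓ
  commutativeRing = record { isCommutativeRing = isCommutativeRing }

  open RawSemiringDefs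
    (Semiring.rawSemiring (CommutativeRing.semiring commutativeRing)) public
    using (_^_; sum) renaming (_×_ to _·_)

  open ToStrict _≡_ _≤_ public using (_<_)

  infixl 7 _/_
  _/_ : ℝ → ℝ → ℝ
  x / y = x * y ⁻¹

  fromℕ : ℕ → ℝ
  fromℕ n = n · 1#

  infix 4 _⟶_
  _⟶_ : (ℕ → ℝ) → ℝ → Set
  s ⟶ l = ∀ δ → 0# < δ →
    ∃[ N ] (∀ m → N ℕ.≤ m → (s m ≤ l + δ) × (l ≤ s m + δ))

  -- A convergent sequence has exactly one limit, so this is the supremum of a
  -- singleton.
  lim : (ℕ → ℝ) → ℝ
  lim s = sup (λ l → s ⟶ l)

  exp : ℝ → ℝ
  exp x = lim (λ m → sum {m} (λ k → x ^ toℕ k / fromℕ (toℕ k !)))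

  -- The inverse of exp on the positive reals: exp is an increasing bijection
  -- from ℝ onto them, so for x > 0 the set is the half-line up to log x.
  log : ℝ → ℝ
  log x = sup (λ y → exp y ≤ x)

  infixr 8 _^ʳ_
  _^ʳ_ : ℝ → ℝ → ℝ
  x ^ʳ y = exp (y * log x)

  IsMaximum : {A : Set} → (A → ℝ) → ℝ → Set
  IsMaximum g M = (∀ a → g a ≤ M) × (∃[ a ] g a ≡ M)

module XOSMaximization (R : RealNumbers) where
  open RealAnalysis R

  SetFunction : ℕ → Set
  SetFunction n = Subset n → ℝ

  Additive : ∀ {n} → SetFunction n → Set
  Additive f =
    ∀ X → f X ≡ sum (λ v → if does (v ∈? X) then f ⁅ v ⁆ else 0#)

  XOS : ∀ {n} → SetFunction n → Set
  XOS {n} f = ∃[ k ] Σ[ g ∈ (Fin k → SetFunction n) ]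
    (∀ i → Additive (g i)) × (∀ X → IsMaximum (λ i → g i X) (f X))

  -- Randomized adaptive algorithms on the ground set Fin n in the value oracle
  -- model.  The set function is not an argument: it is reachable only through
  -- query, whose continuation receives the oracle's answer.  The node
  -- sample m k draws uniformly from a set of m + 1 elements, independently of
  -- all other draws.
  data Algorithm (n : ℕ) : Set where
    return : Subset n → Algorithm n
    query  : Subset n → (ℝ → Algorithm n) → Algorithm n
    sample : (m : ℕ) → (Fin (suc m) → Algorithm n) → Algorithm n

  expectedValue : ∀ {n} → Algorithm n → SetFunction n → ℝ
  expectedValue (return X)   f = f X
  expectedValue (query X k)  f = expectedValue (k (f X)) f
  expectedValue (sample m k) f =
    sum (λ i → expectedValue (k i) f) / fromℕ (suc m)

  -- The number of oracle calls when the oracle answers according to f, for the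
  -- worst outcome of the random draws.
  queries : ∀ {n} → Algorithm n → SetFunction n → ℕ
  queries (return X)   f = 0
  queries (query X k)  f = suc (queries (k (f X)) f)
  queries (sample m k) f = Vector.foldr ℕ._⊔_ 0 (λ i → queries (k i) f)

  IsApproximation : ∀ {n} → ℝ → Algorithm n → Set
  IsApproximation α A =
    ∀ f → XOS f → ∀ M → IsMaximum f M → (1# / α) * M ≤ expectedValue A f

  RunsInO : (∀ n → Algorithm n) → (ℕ → ℝ) → Set
  RunsInO A t = ∃[ C ] ∃[ n₀ ] (∀ n → n₀ ℕ.≤ n → ∀ (f : SetFunction n) →
    XOS f → fromℕ (queries (A n) f) ≤ C * t n)

{-# OPTIONS --safe #-}

-- Split V into b = ⌊εn / log n⌋ nearly equal blocks and query every subset of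
-- every block.  If X* is optimal and g is an additive function of f attaining
-- f(X*), then f(X*) = g(X*) is the sum over the blocks B of
-- g(X* ∩ B) ≤ f(X* ∩ B), so the best queried set has value at least f(X*) / b.
-- A block has at most 1 + n/b elements, and n/b ≤ (7/6) log n / ε as soon as
-- εn / log n ≥ 7; since 2 ≤ e^{6/7}, each block costs O(n^{1/ε}) queries.
--
-- Only exp on [0, ∞) is needed, where its partial sums are increasing.  That
-- exp (log n) is at least n up to a constant follows without the intermediate
-- value theorem: 1 + log n exceeds the supremum defining log n, whence
-- n ≤ exp (1 + log n) = e · exp (log n).
module Submission where

open import Defs
open import Algebra.Bundles using (CommutativeRing)
import Algebra.Properties.CommutativeSemiring.Exp as ExpProperties
import Algebra.Properties.Ring as RingProperties
import Algebra.Properties.Semiring.Mult as MultProperties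
import Algebra.Properties.Semiring.Sum as SumProperties
import Algebra.Solver.Ring.NaturalCoefficients.Default as Solver
open import Axiom.ExcludedMiddle using (ExcludedMiddle)
open import Data.Bool.Base using (Bool; true; false; if_then_else_)
open import Data.Fin.Base using (Fin; toℕ; zero; suc)
open import Data.Fin.Properties using (toℕ<n)
open import Data.Fin.Subset using (Subset; inside; outside; ⊥; ∣_∣; _∩_; ⁅_⁆)
open import Data.Fin.Subset.Properties using (_∈?_)
open import Data.List.Base using (List; []; _∷_; _++_; applyUpTo; concat; length; map)
open import Data.List.Membership.Propositional using (_∈_)
open import Data.List.Membership.Propositional.Properties
  using (∈-++⁺ˡ; ∈-++⁺ʳ; ∈-applyUpTo⁺; ∈-concat⁺′; ∈-map⁺)
open import Data.List.Properties using (length-++; length-map)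
open import Data.List.Relation.Unary.Any using (here; there)
open import Data.Nat.Base as ℕ using (ℕ; zero; suc; _!)
import Data.Nat.Divisibility as ℕ using (∣-refl)
import Data.Nat.DivMod as ℕ
import Data.Nat.Properties as ℕ
open import Data.Product.Base using (Σ-syntax; ∃-syntax; _×_; _,_; proj₁; proj₂)
open import Data.Sum.Base using (inj₁; inj₂; [_,_]′)
open import Data.Vec.Base using ([]; _∷_)
open import Data.Vec.Functional using (Vector)
open import Function.Base using (_∘_)
open import Level using (0ℓ)
open import Relation.Binary.Bundles using (TotalOrder)
open import Relation.Binary.PropositionalEquality
import Relation.Binary.Reasoning.PartialOrder as PartialOrderReasoning
open import Relation.Binary.Structures using (IsTotalOrder)
open import Relation.Nullary.Decidable.Core using (does; yes; no)
open import Relation.Nullary.Negation.Core using (¬_; contradiction)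

-- Arithmetic in an ordered field.

module OrderedField (R : RealNumbers) where
  open RealAnalysis R
  open CommutativeRing commutativeRing public using
    ( +-assoc; +-comm; +-identityˡ; +-identityʳ; -‿inverseˡ; -‿inverseʳ
    ; *-assoc; *-comm; *-identityˡ; *-identityʳ; zeroˡ; zeroʳ
    ; distribˡ; distribʳ; ring; semiring; commutativeSemiring)
  open RingProperties ring public using (-‿distribʳ-*; -‿involutive)
  open MultProperties semiring public using (×-homo-1; ×1-homo-*; ×-assoc-*)
  open ExpProperties commutativeSemiring public using (^-assocʳ)
  open SumProperties semiring public
    using (sum-cong-≗; sum-replicate; sum-replicate-zero; *-distribˡ-sum)
  open Solver commutativeSemiring public using (Polynomial; solve; con; _:=_; _:+_; _:*_)
  open IsTotalOrder isTotalOrder public using (total; antisym)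
    renaming (refl to ≤-refl; trans to ≤-trans; reflexive to ≤-reflexive)

  totalOrder : TotalOrder 0ℓ 0ℓ 0ℓ
  totalOrder = record { isTotalOrder = isTotalOrder }

  -- Unlike con k, this denotes exactly fromℕ k.
  nat : ∀ {n} → ℕ → Polynomial n
  nat zero    = con 0
  nat (suc k) = con 1 :+ nat k

  open PartialOrderReasoning (TotalOrder.poset totalOrder) public

  private variable
    w x y z : ℝ

  x+[-x+y]≡y : ∀ x y → x + (- x + y) ≡ y
  x+[-x+y]≡y x y = begin-equality
    x + (- x + y)  ≡⟨ +-assoc x (- x) y ⟨
    (x + - x) + y  ≡⟨ cong (_+ y) (-‿inverseʳ x) ⟩
    0# + y         ≡⟨ +-identityˡ y ⟩
    y              ∎

  +-mono-≤ : x ≤ y → z ≤ w → x + z ≤ y + w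
  +-mono-≤ {x} {y} {z} {w} x≤y z≤w = begin
    x + z  ≤⟨ +-monoʳ-≤ x z≤w ⟩
    x + w  ≡⟨ +-comm x w ⟩
    w + x  ≤⟨ +-monoʳ-≤ w x≤y ⟩
    w + y  ≡⟨ +-comm w y ⟩
    y + w  ∎

  +-nonneg : 0# ≤ x → 0# ≤ y → 0# ≤ x + y
  +-nonneg 0≤x 0≤y = ≤-trans (≤-reflexive (sym (+-identityˡ 0#))) (+-mono-≤ 0≤x 0≤y)

  x≤x+y : ∀ x → 0# ≤ y → x ≤ x + y
  x≤x+y x 0≤y = ≤-trans (≤-reflexive (sym (+-identityʳ x))) (+-monoʳ-≤ x 0≤y)

  x≤y+x : ∀ x → 0# ≤ y → x ≤ y + x
  x≤y+x {y} x 0≤y = ≤-trans (x≤x+y x 0≤y) (≤-reflexive (+-comm x y))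

  +-cancelˡ-≤ : ∀ x → x + y ≤ x + z → y ≤ z
  +-cancelˡ-≤ {y} {z} x p = begin
    y              ≡⟨ lemma y ⟨
    - x + (x + y)  ≤⟨ +-monoʳ-≤ (- x) p ⟩
    - x + (x + z)  ≡⟨ lemma z ⟩
    z              ∎
    where
    lemma : ∀ y → - x + (x + y) ≡ y
    lemma y = trans (sym (+-assoc (- x) x y))
                    (trans (cong (_+ y) (-‿inverseˡ x)) (+-identityˡ y))

  x≤y⇒0≤-x+y : x ≤ y → 0# ≤ - x + y
  x≤y⇒0≤-x+y {x} {y} x≤y = ≤-trans (≤-reflexive (sym (-‿inverseˡ x))) (+-monoʳ-≤ (- x) x≤y)

  x≤0⇒0≤-x : x ≤ 0# → 0# ≤ - x
  x≤0⇒0≤-x {x} x≤0 = ≤-trans (x≤y⇒0≤-x+y x≤0) (≤-reflexive (+-identityʳ (- x)))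

  *-monoˡ-≤ : 0# ≤ z → x ≤ y → z * x ≤ z * y
  *-monoˡ-≤ {z} {x} {y} 0≤z x≤y = begin
    z * x                    ≤⟨ x≤x+y (z * x) (*-nonneg 0≤z (x≤y⇒0≤-x+y x≤y)) ⟩
    z * x + z * (- x + y)    ≡⟨ distribˡ z x (- x + y) ⟨
    z * (x + (- x + y))      ≡⟨ cong (z *_) (x+[-x+y]≡y x y) ⟩
    z * y                    ∎

  *-monoʳ-≤ : 0# ≤ z → x ≤ y → x * z ≤ y * z
  *-monoʳ-≤ {z} {x} {y} 0≤z x≤y = begin
    x * z  ≡⟨ *-comm x z ⟩
    z * x  ≤⟨ *-monoˡ-≤ 0≤z x≤y ⟩
    z * y  ≡⟨ *-comm z y ⟩
    y * z  ∎

  *-mono-≤ : 0# ≤ x → 0# ≤ w → x ≤ y → w ≤ z → x * w ≤ y * z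
  *-mono-≤ 0≤x 0≤w x≤y w≤z =
    ≤-trans (*-monoʳ-≤ 0≤w x≤y) (*-monoˡ-≤ (≤-trans 0≤x x≤y) w≤z)

  -- If 1 were at most 0, then `- 1#` would be nonnegative, and so would its square, which is 1.
  0≤1 : 0# ≤ 1#
  0≤1 with total 0# 1#
  ... | inj₁ 0≤1 = 0≤1
  ... | inj₂ 1≤0 = begin
    0#           ≤⟨ *-nonneg (x≤0⇒0≤-x 1≤0) (x≤0⇒0≤-x 1≤0) ⟩
    - 1# * - 1#  ≡⟨ -‿distribʳ-* (- 1#) 1# ⟨
    - (- 1# * 1#) ≡⟨ cong -_ (*-identityʳ (- 1#)) ⟩
    - (- 1#)     ≡⟨ -‿involutive 1# ⟩
    1#           ∎

  1≰0 : ¬ 1# ≤ 0#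
  1≰0 1≤0 = 0≢1 (antisym 0≤1 1≤0)

  0<1 : 0# < 1#
  0<1 = 0≤1 , 0≢1

  <⇒≢0 : 0# < x → x ≢ 0#
  <⇒≢0 (_ , 0≢x) x≡0 = 0≢x (sym x≡0)

  1≤⇒0< : 1# ≤ x → 0# < x
  1≤⇒0< 1≤x = ≤-trans 0≤1 1≤x , λ 0≡x → 1≰0 (≤-trans 1≤x (≤-reflexive (sym 0≡x)))

  *-⁻¹-cancelʳ : 0# < z → ∀ x → x * z ⁻¹ * z ≡ x
  *-⁻¹-cancelʳ {z} 0<z x = begin-equality
    x * z ⁻¹ * z    ≡⟨ *-assoc x (z ⁻¹) z ⟩
    x * (z ⁻¹ * z)  ≡⟨ cong (x *_) (trans (*-comm (z ⁻¹) z) (⁻¹-inverse z (<⇒≢0 0<z))) ⟩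
    x * 1#          ≡⟨ *-identityʳ x ⟩
    x               ∎

  *-cancelˡ-≡ : 0# < z → z * x ≡ z * y → x ≡ y
  *-cancelˡ-≡ {z} {x} {y} 0<z zx≡zy = begin-equality
    x               ≡⟨ lemma x ⟨
    z * x * z ⁻¹    ≡⟨ cong (_* z ⁻¹) zx≡zy ⟩
    z * y * z ⁻¹    ≡⟨ lemma y ⟩
    y               ∎
    where
    lemma : ∀ x → z * x * z ⁻¹ ≡ x
    lemma x = begin-equality
      z * x * z ⁻¹    ≡⟨ solve 3 (λ x y z → x :* y :* z := y :* z :* x) refl z x (z ⁻¹) ⟩
      x * z ⁻¹ * z    ≡⟨ *-⁻¹-cancelʳ 0<z x ⟩
      x               ∎

  -- In the case `y ≤ x` the two products are equal by antisymmetry, and an equality cancels by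
  -- means of `z ⁻¹`.
  *-cancelˡ-≤ : 0# < z → z * x ≤ z * y → x ≤ y
  *-cancelˡ-≤ {z} {x} {y} 0<z zx≤zy with total x y
  ... | inj₁ x≤y = x≤y
  ... | inj₂ y≤x = ≤-reflexive
    (*-cancelˡ-≡ 0<z (antisym zx≤zy (*-monoˡ-≤ (proj₁ 0<z) y≤x)))

  ⁻¹-positive : 0# < x → 0# < x ⁻¹
  ⁻¹-positive {x} 0<x = *-cancelˡ-≤ 0<x (begin
    x * 0#    ≡⟨ zeroʳ x ⟩
    0#        ≤⟨ 0≤1 ⟩
    1#        ≡⟨ ⁻¹-inverse x (<⇒≢0 0<x) ⟨
    x * x ⁻¹  ∎) , λ 0≡x⁻¹ → 0≢1 (begin-equality
    0#        ≡⟨ zeroʳ x ⟨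
    x * 0#    ≡⟨ cong (x *_) 0≡x⁻¹ ⟩
    x * x ⁻¹  ≡⟨ ⁻¹-inverse x (<⇒≢0 0<x) ⟩
    1#        ∎)

  *-positive : 0# < x → 0# < y → 0# < x * y
  *-positive {x} {y} 0<x 0<y = *-nonneg (proj₁ 0<x) (proj₁ 0<y) , λ 0≡xy →
    proj₂ 0<y (*-cancelˡ-≡ 0<x (trans (zeroʳ x) 0≡xy))

  ≤-/ : 0# < z → z * x ≤ y → x ≤ y / z
  ≤-/ {z} {x} {y} 0<z zx≤y = *-cancelˡ-≤ 0<z (begin
    z * x      ≤⟨ zx≤y ⟩
    y          ≡⟨ *-⁻¹-cancelʳ 0<z y ⟨
    y / z * z  ≡⟨ *-comm (y / z) z ⟩
    z * (y / z) ∎)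

  <-≤-trans : x < y → y ≤ z → x < z
  <-≤-trans (x≤y , x≢y) y≤z = ≤-trans x≤y y≤z , λ x≡z →
    x≢y (antisym x≤y (≤-trans y≤z (≤-reflexive (sym x≡z))))

  <⇒≱ : x < y → ¬ y ≤ x
  <⇒≱ (x≤y , x≢y) y≤x = x≢y (antisym x≤y y≤x)

  x<y⇒0<-x+y : x < y → 0# < - x + y
  x<y⇒0<-x+y {x} {y} (x≤y , x≢y) = x≤y⇒0≤-x+y x≤y , λ 0≡-x+y → x≢y (begin-equality
    x              ≡⟨ +-identityʳ x ⟨
    x + 0#         ≡⟨ cong (x +_) 0≡-x+y ⟩
    x + (- x + y)  ≡⟨ x+[-x+y]≡y x y ⟩
    y              ∎)

  -- If `y ≤ x`, then `x * x ≤ y * y ≤ x * y`, and the positive factor `x` cancels.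
  square-cancel-≤ : 0# < y → x * x ≤ y * y → x ≤ y
  square-cancel-≤ {y} {x} 0<y xx≤yy with total x y
  ... | inj₁ x≤y = x≤y
  ... | inj₂ y≤x = *-cancelˡ-≤ (<-≤-trans 0<y y≤x)
    (≤-trans xx≤yy (*-monoʳ-≤ (proj₁ 0<y) y≤x))

  fromℕ-* : ∀ m n → fromℕ (m ℕ.* n) ≡ fromℕ m * fromℕ n
  fromℕ-* = ×1-homo-*

  fromℕ-1 : fromℕ 1 ≡ 1#
  fromℕ-1 = ×-homo-1 1#

  0≤fromℕ : ∀ n → 0# ≤ fromℕ n
  0≤fromℕ zero    = ≤-refl
  0≤fromℕ (suc n) = +-nonneg 0≤1 (0≤fromℕ n)

  fromℕ-mono : ∀ {m n} → m ℕ.≤ n → fromℕ m ≤ fromℕ n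
  fromℕ-mono {n = n} ℕ.z≤n = 0≤fromℕ n
  fromℕ-mono (ℕ.s≤s m≤n)   = +-monoʳ-≤ 1# (fromℕ-mono m≤n)

  1≤fromℕ : ∀ {n} → 1 ℕ.≤ n → 1# ≤ fromℕ n
  1≤fromℕ 1≤n = ≤-trans (≤-reflexive (sym fromℕ-1)) (fromℕ-mono 1≤n)

  fromℕ-positive : ∀ {n} → 1 ℕ.≤ n → 0# < fromℕ n
  fromℕ-positive = 1≤⇒0< ∘ 1≤fromℕ

  ^-nonneg : 0# ≤ x → ∀ n → 0# ≤ x ^ n
  ^-nonneg 0≤x zero    = 0≤1
  ^-nonneg 0≤x (suc n) = *-nonneg 0≤x (^-nonneg 0≤x n)

  ^-monoˡ-≤ : 0# ≤ x → x ≤ y → ∀ n → x ^ n ≤ y ^ n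
  ^-monoˡ-≤ 0≤x x≤y zero    = ≤-refl
  ^-monoˡ-≤ 0≤x x≤y (suc n) = *-mono-≤ 0≤x (^-nonneg 0≤x n) x≤y (^-monoˡ-≤ 0≤x x≤y n)

  fromℕ-^ : ∀ m n → fromℕ (m ℕ.^ n) ≡ fromℕ m ^ n
  fromℕ-^ m zero    = fromℕ-1
  fromℕ-^ m (suc n) = trans (fromℕ-* m (m ℕ.^ n)) (cong (fromℕ m *_) (fromℕ-^ m n))

-- Consequences of Dedekind completeness: Archimedean property, integer parts, monotone convergence.

module Completeness (em : ExcludedMiddle 0ℓ) (R : RealNumbers) where
  open RealAnalysis R
  open OrderedField R

  private variable
    u x y : ℝ
    s : ℕ → ℝ

  ≰⇒> : ¬ x ≤ y → y < x
  ≰⇒> {x} {y} x≰y with total x y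
  ... | inj₁ x≤y = contradiction x≤y x≰y
  ... | inj₂ y≤x = y≤x , λ y≡x → x≰y (≤-reflexive (sym y≡x))

  -- Otherwise half of the gap between `y` and `x` is a positive slack that is too small.
  ≤-by-slack : (∀ δ → 0# < δ → x ≤ y + δ) → x ≤ y
  ≤-by-slack {x} {y} slack with em {x ≤ y}
  ... | yes x≤y = x≤y
  ... | no  x≰y = contradiction h≤0 (<⇒≱ 0<h)
    where
    two = 1# + 1#
    0<two = 1≤⇒0< (x≤x+y 1# 0≤1)
    h = (- y + x) / two

    0<h : 0# < h
    0<h = *-positive (x<y⇒0<-x+y (≰⇒> x≰y)) (⁻¹-positive 0<two)

    y+[h+h]≡x : y + (h + h) ≡ x
    y+[h+h]≡x = begin-equality
      y + (h + h)        ≡⟨ solve 2 (λ y h → y :+ (h :+ h) := y :+ h :* (con 1 :+ con 1)) refl y h ⟩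
      y + h * two        ≡⟨ cong (y +_) (*-⁻¹-cancelʳ 0<two (- y + x)) ⟩
      y + (- y + x)      ≡⟨ x+[-x+y]≡y y x ⟩
      x                  ∎

    h≤0 : h ≤ 0#
    h≤0 = +-cancelˡ-≤ (y + h) (begin
      y + h + h    ≡⟨ +-assoc y h h ⟩
      y + (h + h)  ≡⟨ y+[h+h]≡x ⟩
      x            ≤⟨ slack h 0<h ⟩
      y + h        ≡⟨ +-identityʳ (y + h) ⟨
      y + h + 0#   ∎)

  -- If no natural number reached `x`, the naturals would have a supremum `σ`. The successor of each
  -- is at most `σ`, so `- 1# + σ` would be a smaller upper bound.
  archimedean : ∀ x → ∃[ n ] x ≤ fromℕ n
  archimedean x with em {∃[ n ] x ≤ fromℕ n}
  ... | yes bound   = bound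
  ... | no  ¬bound = contradiction (+-cancelˡ-≤ σ σ+1≤σ+0) 1≰0
    where
    Natural : ℝ → Set
    Natural y = ∃[ n ] y ≡ fromℕ n
    σ = sup Natural

    bounded : IsUpperBound _≤_ Natural x
    bounded _ (n , refl) with total (fromℕ n) x
    ... | inj₁ n≤x = n≤x
    ... | inj₂ x≤n = contradiction (n , x≤n) ¬bound

    n≤-1+σ : IsUpperBound _≤_ Natural (- 1# + σ)
    n≤-1+σ _ (n , refl) = +-cancelˡ-≤ 1# (begin
      fromℕ (suc n)    ≤⟨ sup-upper Natural (0# , 0 , refl) (x , bounded) _ (suc n , refl) ⟩
      σ                ≡⟨ x+[-x+y]≡y 1# σ ⟨
      1# + (- 1# + σ)  ∎)

    σ+1≤σ+0 : σ + 1# ≤ σ + 0#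
    σ+1≤σ+0 = begin
      σ + 1#           ≡⟨ +-comm σ 1# ⟩
      1# + σ           ≤⟨ +-monoʳ-≤ 1# (sup-least Natural (0# , 0 , refl) _ n≤-1+σ) ⟩
      1# + (- 1# + σ)  ≡⟨ x+[-x+y]≡y 1# σ ⟩
      σ                ≡⟨ +-identityʳ σ ⟨
      σ + 0#           ∎

  -- For x ≥ 1 the successor of the witness is the integer part of x.
  floor : ∀ x → ∃[ m ] (1# ≤ x → fromℕ (suc m) ≤ x) × x ≤ fromℕ (2 ℕ.+ m)
  floor x = search (proj₁ (archimedean x)) (proj₂ (archimedean x))
    where
    Floor = ∃[ m ] (1# ≤ x → fromℕ (suc m) ≤ x) × x ≤ fromℕ (2 ℕ.+ m)

    -- The witness 0 also serves every `x` below 1, since the lower bound is claimed only for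
    -- `1# ≤ x`.
    floor-≤1 : x ≤ fromℕ 1 → Floor
    floor-≤1 x≤1 = 0 , ≤-trans (≤-reflexive fromℕ-1) , ≤-trans x≤1 (fromℕ-mono (ℕ.n≤1+n 1))

    search : ∀ n → x ≤ fromℕ n → Floor
    search 0             x≤0 = floor-≤1 (≤-trans x≤0 (0≤fromℕ 1))
    search 1             x≤1 = floor-≤1 x≤1
    search (suc (suc n)) x≤n =
      [ (λ 1+n≤x → n , (λ _ → 1+n≤x) , x≤n) , search (suc n) ]′ (total (fromℕ (suc n)) x)

  Increasing : (ℕ → ℝ) → Set
  Increasing s = ∀ {m n} → m ℕ.≤ n → s m ≤ s n

  module MonotoneConvergence
    (increasing : Increasing s) (bounded : ∃[ u ] (∀ m → s m ≤ u)) where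

    private
      Range : ℝ → Set
      Range y = ∃[ m ] y ≡ s m

      l : ℝ
      l = sup Range

      s≤l : ∀ m → s m ≤ l
      s≤l m = sup-upper Range (s 0 , 0 , refl)
        (proj₁ bounded , λ { _ (m , refl) → proj₂ bounded m }) _ (m , refl)

      l-least : (∀ m → s m ≤ u) → l ≤ u
      l-least s≤u = sup-least Range (s 0 , 0 , refl) _ λ { _ (m , refl) → s≤u m }

      -- If every term stayed more than `δ` below `l`, then `- δ + l` would bound the range. Once
      -- one term is close, monotonicity keeps all later ones close.
      s⟶l : s ⟶ l
      s⟶l δ 0<δ with em {∃[ N ] l ≤ s N + δ}
      ... | yes (N , l≤sN+δ) = N , λ m N≤m →
        ≤-trans (s≤l m) (x≤x+y l (proj₁ 0<δ)) ,
        ≤-trans l≤sN+δ (+-mono-≤ (increasing N≤m) ≤-refl)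
      ... | no far = contradiction (+-cancelˡ-≤ l l+δ≤l+0) (<⇒≱ 0<δ)
        where
        s≤-δ+l : ∀ m → s m ≤ - δ + l
        s≤-δ+l m = +-cancelˡ-≤ δ (begin
          δ + s m        ≡⟨ +-comm δ (s m) ⟩
          s m + δ        ≤⟨ proj₁ (≰⇒> (λ l≤ → far (m , l≤))) ⟩
          l              ≡⟨ x+[-x+y]≡y δ l ⟨
          δ + (- δ + l)  ∎)

        l+δ≤l+0 : l + δ ≤ l + 0#
        l+δ≤l+0 = begin
          l + δ          ≡⟨ +-comm l δ ⟩
          δ + l          ≤⟨ +-monoʳ-≤ δ (l-least s≤-δ+l) ⟩
          δ + (- δ + l)  ≡⟨ x+[-x+y]≡y δ l ⟩
          l              ≡⟨ +-identityʳ l ⟨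
          l + 0#         ∎

      limit≤l : IsUpperBound _≤_ (s ⟶_) l
      limit≤l l′ s⟶l′ = ≤-by-slack λ δ 0<δ →
        let N , near = s⟶l′ δ 0<δ in
        ≤-trans (proj₂ (near N ℕ.≤-refl)) (+-mono-≤ (s≤l N) ≤-refl)

    -- `lim s` is the supremum of the set of limits of `s`. To use its properties, that set has to
    -- be nonempty, by `s⟶l`, and bounded, by `limit≤l`.
    ≤-lim : ∀ m → s m ≤ lim s
    ≤-lim m = ≤-trans (s≤l m) (sup-upper (s ⟶_) (l , s⟶l) (l , limit≤l) l s⟶l)

    lim-least : (∀ m → s m ≤ u) → lim s ≤ u
    lim-least s≤u = ≤-trans (sup-least (s ⟶_) (l , s⟶l) l limit≤l) (l-least s≤u)

-- Finite sums, Cauchy products and formal derivatives of coefficient sequences.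

module Convolution (R : RealNumbers) where
  open RealAnalysis R
  open OrderedField R

  private variable
    a b : ℕ → ℝ

  Σ< : (ℕ → ℝ) → ℕ → ℝ
  Σ< a m = sum {m} (a ∘ toℕ)

  Σ<-nonneg : (∀ k → 0# ≤ a k) → ∀ m → 0# ≤ Σ< a m
  Σ<-nonneg 0≤a zero    = ≤-refl
  Σ<-nonneg 0≤a (suc m) = +-nonneg (0≤a 0) (Σ<-nonneg (0≤a ∘ suc) m)

  sum-mono-≤ : ∀ {n} {s t : Vector ℝ n} → (∀ i → s i ≤ t i) → sum s ≤ sum t
  sum-mono-≤ {zero}  s≤t = ≤-refl
  sum-mono-≤ {suc n} s≤t = +-mono-≤ (s≤t zero) (sum-mono-≤ (s≤t ∘ suc))

  Σ<-last : ∀ (a : ℕ → ℝ) m → Σ< a (suc m) ≡ a m + Σ< a m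
  Σ<-last a zero    = refl
  Σ<-last a (suc m) = trans (cong (a 0 +_) (Σ<-last (a ∘ suc) m))
    (solve 3 (λ x y z → x :+ (y :+ z) := y :+ (x :+ z)) refl (a 0) (a (suc m)) _)

  Σ<-increasing : (∀ k → 0# ≤ a k) → ∀ {m n} → m ℕ.≤ n → Σ< a m ≤ Σ< a n
  Σ<-increasing 0≤a {n = n} ℕ.z≤n = Σ<-nonneg 0≤a n
  Σ<-increasing 0≤a (ℕ.s≤s m≤n)   = +-monoʳ-≤ _ (Σ<-increasing (0≤a ∘ suc) m≤n)

  Σ<-cong : (∀ k → a k ≡ b k) → ∀ m → Σ< a m ≡ Σ< b m
  Σ<-cong a≡b m = sum-cong-≗ {m} (a≡b ∘ toℕ)

  -- The summand has the shape of the recursive clause of `_⋆_`.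
  Σ<-*ˡ-+ : ∀ x (b c : ℕ → ℝ) m → Σ< (λ k → x * b k + c k) m ≡ x * Σ< b m + Σ< c m
  Σ<-*ˡ-+ x b c zero    = solve 1 (λ x → con 0 := x :* con 0 :+ con 0) refl x
  Σ<-*ˡ-+ x b c (suc m) = trans
    (cong (x * b 0 + c 0 +_) (Σ<-*ˡ-+ x (b ∘ suc) (c ∘ suc) m))
    (solve 5 (λ x b c B C → x :* b :+ c :+ (x :* B :+ C) := x :* (b :+ B) :+ (c :+ C))
      refl x (b 0) (c 0) (Σ< (b ∘ suc) m) (Σ< (c ∘ suc) m))

  infixl 7 _⋆_
  -- The Cauchy product, that is, the coefficients of the product of two power series, with the
  -- contribution of `a 0` split off.
  _⋆_ : (ℕ → ℝ) → (ℕ → ℝ) → ℕ → ℝ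
  (a ⋆ b) zero    = a 0 * b 0
  (a ⋆ b) (suc k) = a 0 * b (suc k) + ((a ∘ suc) ⋆ b) k

  ⋆-nonneg : (∀ k → 0# ≤ a k) → (∀ k → 0# ≤ b k) → ∀ k → 0# ≤ (a ⋆ b) k
  ⋆-nonneg 0≤a 0≤b zero    = *-nonneg (0≤a 0) (0≤b 0)
  ⋆-nonneg 0≤a 0≤b (suc k) =
    +-nonneg (*-nonneg (0≤a 0) (0≤b (suc k))) (⋆-nonneg (0≤a ∘ suc) 0≤b k)

  ⋆-cong : ∀ {a a′ b b′ : ℕ → ℝ} → (∀ k → a k ≡ a′ k) → (∀ k → b k ≡ b′ k) →
           ∀ k → (a ⋆ b) k ≡ (a′ ⋆ b′) k
  ⋆-cong a≡ b≡ zero    = cong₂ _*_ (a≡ 0) (b≡ 0)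
  ⋆-cong a≡ b≡ (suc k) = cong₂ _+_ (cong₂ _*_ (a≡ 0) (b≡ (suc k))) (⋆-cong (a≡ ∘ suc) b≡ k)

  ⋆-distribʳ-+ : ∀ (a b c : ℕ → ℝ) k → ((λ j → a j + b j) ⋆ c) k ≡ (a ⋆ c) k + (b ⋆ c) k
  ⋆-distribʳ-+ a b c zero    = distribʳ (c 0) (a 0) (b 0)
  ⋆-distribʳ-+ a b c (suc k) = trans
    (cong ((a 0 + b 0) * c (suc k) +_) (⋆-distribʳ-+ (a ∘ suc) (b ∘ suc) c k))
    (solve 5 (λ a b c A B → (a :+ b) :* c :+ (A :+ B) := a :* c :+ A :+ (b :* c :+ B))
      refl (a 0) (b 0) (c (suc k)) _ _)

  ⋆-scaleˡ : ∀ x (a b : ℕ → ℝ) k → ((λ j → x * a j) ⋆ b) k ≡ x * (a ⋆ b) k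
  ⋆-scaleˡ x a b zero    = *-assoc x (a 0) (b 0)
  ⋆-scaleˡ x a b (suc k) = trans
    (cong (x * a 0 * b (suc k) +_) (⋆-scaleˡ x (a ∘ suc) b k))
    (solve 4 (λ x a b A → x :* a :* b :+ x :* A := x :* (a :* b :+ A))
      refl x (a 0) (b (suc k)) _)

  ⋆-scaleʳ : ∀ x (a b : ℕ → ℝ) k → (a ⋆ (λ j → x * b j)) k ≡ x * (a ⋆ b) k
  ⋆-scaleʳ x a b zero    = solve 3 (λ x a b → a :* (x :* b) := x :* (a :* b)) refl x (a 0) (b 0)
  ⋆-scaleʳ x a b (suc k) = trans
    (cong (a 0 * (x * b (suc k)) +_) (⋆-scaleʳ x (a ∘ suc) b k))
    (solve 4 (λ x a b A → a :* (x :* b) :+ x :* A := x :* (a :* b :+ A))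
      refl x (a 0) (b (suc k)) _)

  -- The left side adds `a i * b j` over the triangle `i + j < m`, the right side over the square
  -- `i, j < m` that contains it.
  Σ<-⋆-≤ : (∀ k → 0# ≤ a k) → (∀ k → 0# ≤ b k) → ∀ m → Σ< (a ⋆ b) m ≤ Σ< a m * Σ< b m
  Σ<-⋆-≤ 0≤a 0≤b zero = ≤-reflexive (sym (zeroˡ 0#))
  Σ<-⋆-≤ {a} {b} 0≤a 0≤b (suc m) = begin
    Σ< (a ⋆ b) (suc m)
      ≡⟨ cong (a 0 * b 0 +_) (Σ<-*ˡ-+ (a 0) (b ∘ suc) ((a ∘ suc) ⋆ b) m) ⟩
    a 0 * b 0 + (a 0 * Σ< (b ∘ suc) m + Σ< ((a ∘ suc) ⋆ b) m)
      ≤⟨ +-monoʳ-≤ _ (+-monoʳ-≤ _ (≤-trans (Σ<-⋆-≤ (0≤a ∘ suc) 0≤b m)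
           (*-monoˡ-≤ (Σ<-nonneg (0≤a ∘ suc) m) (Σ<-increasing 0≤b (ℕ.n≤1+n m))))) ⟩
    a 0 * b 0 + (a 0 * Σ< (b ∘ suc) m + Σ< (a ∘ suc) m * Σ< b (suc m))
      ≡⟨ solve 4 (λ a b A B → a :* b :+ (a :* B :+ A :* (b :+ B)) := (a :+ A) :* (b :+ B))
           refl (a 0) (b 0) (Σ< (a ∘ suc) m) (Σ< (b ∘ suc) m) ⟩
    Σ< a (suc m) * Σ< b (suc m) ∎

  -- The rectangle `i < m`, `j < n` lies in the triangle `i + j < m + n`.
  ≤-Σ<-⋆ : (∀ k → 0# ≤ a k) → (∀ k → 0# ≤ b k) →
           ∀ m n → Σ< a m * Σ< b n ≤ Σ< (a ⋆ b) (m ℕ.+ n)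
  ≤-Σ<-⋆ {b = b} 0≤a 0≤b zero n = ≤-trans (≤-reflexive (zeroˡ (Σ< b n)))
    (Σ<-nonneg (⋆-nonneg 0≤a 0≤b) n)
  ≤-Σ<-⋆ {a} {b} 0≤a 0≤b (suc m) n = begin
    (a 0 + Σ< (a ∘ suc) m) * Σ< b n
      ≡⟨ distribʳ (Σ< b n) (a 0) (Σ< (a ∘ suc) m) ⟩
    a 0 * Σ< b n + Σ< (a ∘ suc) m * Σ< b n
      ≤⟨ +-mono-≤ (*-monoˡ-≤ (0≤a 0) (Σ<-increasing 0≤b (ℕ.m≤n+m n (suc m))))
                  (≤-Σ<-⋆ (0≤a ∘ suc) 0≤b m n) ⟩
    a 0 * Σ< b (suc (m ℕ.+ n)) + Σ< ((a ∘ suc) ⋆ b) (m ℕ.+ n)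
      ≡⟨ solve 4 (λ a b B C → a :* (b :+ B) :+ C := a :* b :+ (a :* B :+ C)) refl (a 0) (b 0) _ _ ⟩
    a 0 * b 0 + (a 0 * Σ< (b ∘ suc) (m ℕ.+ n) + Σ< ((a ∘ suc) ⋆ b) (m ℕ.+ n))
      ≡⟨ cong (a 0 * b 0 +_) (Σ<-*ˡ-+ (a 0) (b ∘ suc) ((a ∘ suc) ⋆ b) (m ℕ.+ n)) ⟨
    Σ< (a ⋆ b) (suc m ℕ.+ n) ∎

  -- The coefficients of the formal derivative of Σ aₖ xᵏ.
  D : (ℕ → ℝ) → ℕ → ℝ
  D a k = fromℕ (suc k) * a (suc k)

  -- The product rule. It lets `expTerm-+` be proved by comparing formal derivatives instead of
  -- expanding binomial coefficients.
  leibniz : ∀ (a b : ℕ → ℝ) k → D (a ⋆ b) k ≡ (D a ⋆ b) k + (a ⋆ D b) k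
  leibniz a b zero =
    solve 5 (λ o a₀ a₁ b₀ b₁ → o :* (a₀ :* b₁ :+ a₁ :* b₀) := o :* a₁ :* b₀ :+ a₀ :* (o :* b₁))
      refl (fromℕ 1) (a 0) (a 1) (b 0) (b 1)
  leibniz a b (suc k) = begin-equality
    (1# + K) * (a 0 * b (2 ℕ.+ k) + (a 1 * b (suc k) + E))
      -- In the factor `1# + K`, the summand `K` turns the tail into `D (a′ ⋆ b) k`, to which
      -- induction applies; the summand `1#` leaves one copy of the tail, which `D-shift` absorbs.
      ≡⟨ solve 6 (λ a₀ a₁ b₁ b₂ K E → (con 1 :+ K) :* (a₀ :* b₂ :+ (a₁ :* b₁ :+ E)) :=
           a₀ :* ((con 1 :+ K) :* b₂) :+ (a₁ :* b₁ :+ E) :+ K :* (a₁ :* b₁ :+ E))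
           refl (a 0) (a 1) (b (suc k)) (b (2 ℕ.+ k)) K E ⟩
    a 0 * D b (suc k) + (a 1 * b (suc k) + E) + D (a′ ⋆ b) k
      ≡⟨ cong₂ (λ z w → a 0 * D b (suc k) + (z * b (suc k) + E) + w)
           (sym (trans (cong (_* a 1) fromℕ-1) (*-identityˡ (a 1)))) (leibniz a′ b k) ⟩
    a 0 * D b (suc k) + (D a 0 * b (suc k) + E) + ((D a′ ⋆ b) k + (a′ ⋆ D b) k)
      ≡⟨ solve 5 (λ x y E P Q → x :+ (y :+ E) :+ (P :+ Q) := y :+ (E :+ P) :+ (x :+ Q))
           refl _ _ E ((D a′ ⋆ b) k) ((a′ ⋆ D b) k) ⟩
    D a 0 * b (suc k) + (E + (D a′ ⋆ b) k) + (a ⋆ D b) (suc k)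
      ≡⟨ cong (λ z → D a 0 * b (suc k) + z + (a ⋆ D b) (suc k)) (begin-equality
           E + (D a′ ⋆ b) k                              ≡⟨ ⋆-distribʳ-+ (a′ ∘ suc) (D a′) b k ⟨
           ((λ j → a′ (suc j) + D a′ j) ⋆ b) k          ≡⟨ ⋆-cong D-shift (λ _ → refl) k ⟨
           ((D a ∘ suc) ⋆ b) k                           ∎) ⟩
    (D a ⋆ b) (suc k) + (a ⋆ D b) (suc k) ∎
    where
    a′ = a ∘ suc
    K = fromℕ (suc k)
    E = ((a′ ∘ suc) ⋆ b) k

    D-shift : ∀ j → D a (suc j) ≡ a′ (suc j) + D a′ j
    D-shift j = solve 2 (λ K x → (con 1 :+ K) :* x := x :+ K :* x) refl (fromℕ (suc j)) (a (2 ℕ.+ j))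

-- The exponential function on nonnegative reals.

module Exponential (em : ExcludedMiddle 0ℓ) (R : RealNumbers) where
  open RealAnalysis R
  open OrderedField R
  open Completeness em R
  open Convolution R

  private variable
    u x y z : ℝ

  expTerm : ℝ → ℕ → ℝ
  expTerm x k = x ^ k / fromℕ (k !)

  partialExp : ℝ → ℕ → ℝ
  partialExp x = Σ< (expTerm x)

  0<k! : ∀ k → 0# < fromℕ (k !)
  0<k! k = fromℕ-positive (ℕ.1≤n! k)

  k!*expTerm : ∀ x k → fromℕ (k !) * expTerm x k ≡ x ^ k
  k!*expTerm x k = trans (*-comm _ _) (*-⁻¹-cancelʳ (0<k! k) (x ^ k))

  expTerm-0 : ∀ x → expTerm x 0 ≡ 1#
  expTerm-0 x = begin-equality
    expTerm x 0             ≡⟨ *-identityˡ _ ⟨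
    1# * expTerm x 0        ≡⟨ cong (_* expTerm x 0) fromℕ-1 ⟨
    fromℕ 1 * expTerm x 0   ≡⟨ k!*expTerm x 0 ⟩
    1#                      ∎

  -- `expTerm x` lists the coefficients of e^(xt) as a power series in t, whose derivative is x
  -- times the series itself.
  D-expTerm : ∀ x k → D (expTerm x) k ≡ x * expTerm x k
  D-expTerm x k = *-cancelˡ-≡ (0<k! k) (begin-equality
    fromℕ (k !) * (fromℕ (suc k) * expTerm x (suc k))
      ≡⟨ solve 3 (λ a b c → a :* (b :* c) := b :* a :* c) refl _ (fromℕ (suc k)) _ ⟩
    fromℕ (suc k) * fromℕ (k !) * expTerm x (suc k)
      ≡⟨ cong (_* expTerm x (suc k)) (fromℕ-* (suc k) (k !)) ⟨
    fromℕ (suc k !) * expTerm x (suc k)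
      ≡⟨ k!*expTerm x (suc k) ⟩
    x * x ^ k
      ≡⟨ cong (x *_) (k!*expTerm x k) ⟨
    x * (fromℕ (k !) * expTerm x k)
      ≡⟨ solve 3 (λ a b c → a :* (b :* c) := b :* (a :* c)) refl x _ _ ⟩
    fromℕ (k !) * (x * expTerm x k) ∎)

  -- This is the binomial theorem divided by `k !`. Both sequences start with 1, and both satisfy
  -- the recursion in which `D` multiplies by `x + y`: the left one by `D-expTerm`, the right one by
  -- `leibniz`.
  expTerm-+ : ∀ x y k → expTerm (x + y) k ≡ (expTerm x ⋆ expTerm y) k
  expTerm-+ x y zero = begin-equality
    expTerm (x + y) 0          ≡⟨ expTerm-0 (x + y) ⟩
    1#                         ≡⟨ *-identityˡ 1# ⟨
    1# * 1#                    ≡⟨ cong₂ _*_ (expTerm-0 x) (expTerm-0 y) ⟨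
    expTerm x 0 * expTerm y 0  ∎
  expTerm-+ x y (suc k) = *-cancelˡ-≡ (fromℕ-positive {suc k} (ℕ.s≤s ℕ.z≤n)) (begin-equality
    D (expTerm (x + y)) k
      ≡⟨ D-expTerm (x + y) k ⟩
    (x + y) * expTerm (x + y) k
      ≡⟨ cong ((x + y) *_) (expTerm-+ x y k) ⟩
    (x + y) * (expTerm x ⋆ expTerm y) k
      ≡⟨ distribʳ _ x y ⟩
    x * (expTerm x ⋆ expTerm y) k + y * (expTerm x ⋆ expTerm y) k
      ≡⟨ cong₂ _+_ (trans (⋆-cong (D-expTerm x) (λ _ → refl) k) (⋆-scaleˡ x (expTerm x) (expTerm y) k))
                   (trans (⋆-cong (λ _ → refl) (D-expTerm y) k) (⋆-scaleʳ y (expTerm x) (expTerm y) k)) ⟨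
    (D (expTerm x) ⋆ expTerm y) k + (expTerm x ⋆ D (expTerm y)) k
      ≡⟨ leibniz (expTerm x) (expTerm y) k ⟨
    D (expTerm x ⋆ expTerm y) k ∎)

  expTerm-nonneg : 0# ≤ x → ∀ k → 0# ≤ expTerm x k
  expTerm-nonneg 0≤x k = *-nonneg (^-nonneg 0≤x k) (proj₁ (⁻¹-positive (0<k! k)))

  partialExp-increasing : 0# ≤ x → Increasing (partialExp x)
  partialExp-increasing 0≤x = Σ<-increasing (expTerm-nonneg 0≤x)

  partialExp-nonneg : 0# ≤ x → ∀ m → 0# ≤ partialExp x m
  partialExp-nonneg 0≤x = Σ<-nonneg (expTerm-nonneg 0≤x)

  partialExp-+-≤ : 0# ≤ x → 0# ≤ y → ∀ m → partialExp (x + y) m ≤ partialExp x m * partialExp y m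
  partialExp-+-≤ {x} {y} 0≤x 0≤y m = begin
    partialExp (x + y) m             ≡⟨ Σ<-cong (expTerm-+ x y) m ⟩
    Σ< (expTerm x ⋆ expTerm y) m     ≤⟨ Σ<-⋆-≤ (expTerm-nonneg 0≤x) (expTerm-nonneg 0≤y) m ⟩
    partialExp x m * partialExp y m  ∎

  partialExp-*-≤ : 0# ≤ x → 0# ≤ y →
                   ∀ m n → partialExp x m * partialExp y n ≤ partialExp (x + y) (m ℕ.+ n)
  partialExp-*-≤ {x} {y} 0≤x 0≤y m n = begin
    partialExp x m * partialExp y n          ≤⟨ ≤-Σ<-⋆ (expTerm-nonneg 0≤x) (expTerm-nonneg 0≤y) m n ⟩
    Σ< (expTerm x ⋆ expTerm y) (m ℕ.+ n)     ≡⟨ Σ<-cong (expTerm-+ x y) (m ℕ.+ n) ⟨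
    partialExp (x + y) (m ℕ.+ n)             ∎

  expTerm-≤-^ : 0# ≤ x → ∀ k → expTerm x k ≤ x ^ k
  expTerm-≤-^ {x} 0≤x k = begin
    expTerm x k                ≡⟨ *-identityˡ _ ⟨
    1# * expTerm x k           ≤⟨ *-monoʳ-≤ (expTerm-nonneg 0≤x k) (1≤fromℕ (ℕ.1≤n! k)) ⟩
    fromℕ (k !) * expTerm x k  ≡⟨ k!*expTerm x k ⟩
    x ^ k                      ∎

  geometric-≤2 : 0# ≤ x → x + x ≤ 1# → ∀ m → Σ< (x ^_) m ≤ 1# + 1#
  geometric-≤2 0≤x x+x≤1 zero = +-nonneg 0≤1 0≤1
  geometric-≤2 {x} 0≤x x+x≤1 (suc m) = +-monoʳ-≤ 1# (begin
    Σ< (λ k → x * x ^ k) m    ≡⟨ *-distribˡ-sum {m} x _ ⟨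
    x * Σ< (x ^_) m           ≤⟨ *-monoˡ-≤ 0≤x (geometric-≤2 0≤x x+x≤1 m) ⟩
    x * (1# + 1#)             ≡⟨ solve 1 (λ x → x :* (con 1 :+ con 1) := x :+ x) refl x ⟩
    x + x                     ≤⟨ x+x≤1 ⟩
    1#                        ∎)

  ExpBounded : ℝ → Set
  ExpBounded x = ∃[ u ] (∀ m → partialExp x m ≤ u)

  -- The geometric series with ratio at most 1/2 dominates.
  expBounded-≤½ : 0# ≤ x → x + x ≤ 1# → ExpBounded x
  expBounded-≤½ 0≤x x+x≤1 = 1# + 1# , λ m →
    ≤-trans (sum-mono-≤ (expTerm-≤-^ 0≤x ∘ toℕ {m})) (geometric-≤2 0≤x x+x≤1 m)

  expBounded-+ : 0# ≤ x → 0# ≤ y → ExpBounded x → ExpBounded y → ExpBounded (x + y)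
  expBounded-+ 0≤x 0≤y (u , x≤u) (v , y≤v) = u * v , λ m →
    ≤-trans (partialExp-+-≤ 0≤x 0≤y m)
            (*-mono-≤ (partialExp-nonneg 0≤x m) (partialExp-nonneg 0≤y m) (x≤u m) (y≤v m))

  fromℕ-*-suc : ∀ n x → fromℕ (suc n) * x ≡ x + fromℕ n * x
  fromℕ-*-suc n x = solve 2 (λ n x → (con 1 :+ n) :* x := x :+ n :* x) refl (fromℕ n) x

  expBounded-fromℕ-* : ∀ n → 0# ≤ x → x + x ≤ 1# → ExpBounded (fromℕ n * x)
  expBounded-fromℕ-* {x} zero 0≤x x+x≤1 = subst ExpBounded (sym (zeroˡ x))
    (expBounded-≤½ ≤-refl (≤-trans (≤-reflexive (+-identityˡ 0#)) 0≤1))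
  expBounded-fromℕ-* {x} (suc n) 0≤x x+x≤1 = subst ExpBounded (sym (fromℕ-*-suc n x))
    (expBounded-+ 0≤x (*-nonneg (0≤fromℕ n) 0≤x) (expBounded-≤½ 0≤x x+x≤1)
      (expBounded-fromℕ-* n 0≤x x+x≤1))

  -- For a natural number `N` above `x + x`, `x` is the sum of `N` copies of `x / N`, each at most
  -- 1/2, and boundedness passes to sums by `expBounded-+`.
  expBounded : 0# ≤ x → ExpBounded x
  expBounded {x} 0≤x = subst ExpBounded (trans (*-comm N h) (*-⁻¹-cancelʳ 0<N x))
    (expBounded-fromℕ-* (suc n) 0≤h (begin
      h + h            ≡⟨ distribʳ (N ⁻¹) x x ⟨
      (x + x) * N ⁻¹   ≤⟨ *-monoʳ-≤ (proj₁ (⁻¹-positive 0<N))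
                            (≤-trans (proj₂ (archimedean (x + x))) (x≤y+x _ 0≤1)) ⟩
      N * N ⁻¹         ≡⟨ ⁻¹-inverse N (<⇒≢0 0<N) ⟩
      1#               ∎))
    where
    n = proj₁ (archimedean (x + x))
    N = fromℕ (suc n)
    0<N = fromℕ-positive {suc n} (ℕ.s≤s ℕ.z≤n)
    h = x / N
    0≤h = *-nonneg 0≤x (proj₁ (⁻¹-positive 0<N))

  partialExp≤exp : 0# ≤ x → ∀ m → partialExp x m ≤ exp x
  partialExp≤exp 0≤x = MonotoneConvergence.≤-lim (partialExp-increasing 0≤x) (expBounded 0≤x)

  exp-least : 0# ≤ x → (∀ m → partialExp x m ≤ u) → exp x ≤ u
  exp-least 0≤x = MonotoneConvergence.lim-least (partialExp-increasing 0≤x) (expBounded 0≤x)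

  exp-nonneg : 0# ≤ x → 0# ≤ exp x
  exp-nonneg 0≤x = partialExp≤exp 0≤x 0

  -- For positive `z` the partial sums are bounded by `u / z`. For `z` equal to 0 the empty partial
  -- sum already gives `0# ≤ u`.
  *-exp-least : 0# ≤ z → 0# ≤ x → (∀ m → z * partialExp x m ≤ u) → z * exp x ≤ u
  *-exp-least {z} {x} {u} 0≤z 0≤x z*≤u with em {0# ≡ z}
  ... | yes refl = ≤-trans (≤-reflexive (trans (zeroˡ (exp x)) (sym (zeroˡ 0#)))) (z*≤u 0)
  ... | no  0≢z  = begin
    z * exp x    ≤⟨ *-monoˡ-≤ 0≤z (exp-least 0≤x λ m → ≤-/ (0≤z , 0≢z) (z*≤u m)) ⟩
    z * (u / z)  ≡⟨ trans (*-comm z (u / z)) (*-⁻¹-cancelʳ (0≤z , 0≢z) u) ⟩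
    u            ∎

  -- One direction bounds the triangle by the square. The other bounds rectangles by triangles and
  -- passes to the limit in one factor at a time.
  exp-+ : 0# ≤ x → 0# ≤ y → exp (x + y) ≡ exp x * exp y
  exp-+ {x} {y} 0≤x 0≤y = antisym
    (exp-least (+-nonneg 0≤x 0≤y) λ m → begin
      partialExp (x + y) m             ≤⟨ partialExp-+-≤ 0≤x 0≤y m ⟩
      partialExp x m * partialExp y m  ≤⟨ *-mono-≤ (partialExp-nonneg 0≤x m) (partialExp-nonneg 0≤y m)
                                            (partialExp≤exp 0≤x m) (partialExp≤exp 0≤y m) ⟩
      exp x * exp y                    ∎)
    (begin
      exp x * exp y                    ≡⟨ *-comm (exp x) (exp y) ⟩
      exp y * exp x                    ≤⟨ *-exp-least (exp-nonneg 0≤y) 0≤x (λ m → begin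
        exp y * partialExp x m            ≡⟨ *-comm (exp y) _ ⟩
        partialExp x m * exp y            ≤⟨ *-exp-least (partialExp-nonneg 0≤x m) 0≤y (λ n →
          ≤-trans (partialExp-*-≤ 0≤x 0≤y m n) (partialExp≤exp (+-nonneg 0≤x 0≤y) (m ℕ.+ n))) ⟩
        exp (x + y)                       ∎) ⟩
      exp (x + y)                      ∎)

  1+x≤exp : 0# ≤ x → 1# + x ≤ exp x
  1+x≤exp {x} 0≤x = begin
    1# + x                              ≡⟨ cong₂ _+_ (expTerm-0 x) x≡term ⟨
    expTerm x 0 + (expTerm x 1 + 0#)    ≤⟨ partialExp≤exp 0≤x 2 ⟩
    exp x                               ∎
    where
    x≡term : expTerm x 1 + 0# ≡ x
    x≡term = begin-equality
      expTerm x 1 + 0#          ≡⟨ +-identityʳ _ ⟩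
      expTerm x 1               ≡⟨ *-identityˡ _ ⟨
      1# * expTerm x 1          ≡⟨ cong (_* expTerm x 1) fromℕ-1 ⟨
      fromℕ 1 * expTerm x 1     ≡⟨ k!*expTerm x 1 ⟩
      x * 1#                    ≡⟨ *-identityʳ x ⟩
      x                         ∎

  1≤exp : 0# ≤ x → 1# ≤ exp x
  1≤exp 0≤x = ≤-trans (x≤x+y 1# 0≤x) (1+x≤exp 0≤x)

  -- This is the quadratic term of the series; it makes the logarithm sublinear in `log-≤-linear`.
  x²≤2exp : 0# ≤ x → x * x ≤ fromℕ 2 * exp x
  x²≤2exp {x} 0≤x = begin
    x * x                  ≡⟨ cong (x *_) (*-identityʳ x) ⟨
    x ^ 2                  ≡⟨ k!*expTerm x 2 ⟨
    fromℕ 2 * expTerm x 2  ≤⟨ *-monoˡ-≤ (0≤fromℕ 2) (≤-trans term≤sum (partialExp≤exp 0≤x 3)) ⟩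
    fromℕ 2 * exp x        ∎
    where
    0≤term = expTerm-nonneg 0≤x
    term≤sum : expTerm x 2 ≤ partialExp x 3
    term≤sum = ≤-trans (x≤x+y _ ≤-refl) (≤-trans (x≤y+x _ (0≤term 1)) (x≤y+x _ (0≤term 0)))

  exp-mono-≤ : 0# ≤ x → x ≤ y → exp x ≤ exp y
  exp-mono-≤ {x} {y} 0≤x x≤y = begin
    exp x                   ≡⟨ *-identityʳ (exp x) ⟨
    exp x * 1#              ≤⟨ *-monoˡ-≤ (exp-nonneg 0≤x) (1≤exp 0≤y-x) ⟩
    exp x * exp (- x + y)   ≡⟨ exp-+ 0≤x 0≤y-x ⟨
    exp (x + (- x + y))     ≡⟨ cong exp (x+[-x+y]≡y x y) ⟩
    exp y                   ∎
    where 0≤y-x = x≤y⇒0≤-x+y x≤y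

  1+x^n≤exp : 0# ≤ x → ∀ n → (1# + x) ^ n ≤ exp (fromℕ n * x)
  1+x^n≤exp 0≤x zero = 1≤exp (*-nonneg ≤-refl 0≤x)
  1+x^n≤exp {x} 0≤x (suc n) = begin
    (1# + x) * (1# + x) ^ n       ≤⟨ *-mono-≤ (+-nonneg 0≤1 0≤x) (^-nonneg (+-nonneg 0≤1 0≤x) n)
                                       (1+x≤exp 0≤x) (1+x^n≤exp 0≤x n) ⟩
    exp x * exp (fromℕ n * x)     ≡⟨ exp-+ 0≤x (*-nonneg (0≤fromℕ n) 0≤x) ⟨
    exp (x + fromℕ n * x)         ≡⟨ cong exp (fromℕ-*-suc n x) ⟨
    exp (fromℕ (suc n) * x)       ∎

  -- The factor 7/6 leaves room for rounding the block sizes; e^{6/7} ≥ (10/7)² ≥ 2.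
  2^n≤exp : ∀ n → fromℕ 6 * fromℕ n ≤ fromℕ 7 * x → fromℕ 2 ^ n ≤ exp x
  2^n≤exp {x} n 6n≤7x = begin
    fromℕ 2 ^ n                   ≤⟨ ^-monoˡ-≤ (0≤fromℕ 2) 2≤[1+r]² n ⟩
    ((1# + r) ^ 2) ^ n            ≡⟨ ^-assocʳ (1# + r) 2 n ⟩
    (1# + r) ^ (2 ℕ.* n)          ≤⟨ 1+x^n≤exp 0≤r (2 ℕ.* n) ⟩
    exp (fromℕ (2 ℕ.* n) * r)     ≤⟨ exp-mono-≤ (*-nonneg (0≤fromℕ (2 ℕ.* n)) 0≤r) 2nr≤x ⟩
    exp x                         ∎
    where
    0<7 = fromℕ-positive {7} (ℕ.s≤s ℕ.z≤n)
    h = fromℕ 7 ⁻¹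
    0<h = ⁻¹-positive 0<7
    7h≡1 = ⁻¹-inverse (fromℕ 7) (<⇒≢0 0<7)
    r = fromℕ 3 * h
    0≤r = *-nonneg (0≤fromℕ 3) (proj₁ 0<h)

    2≤[1+r]² : fromℕ 2 ≤ (1# + r) ^ 2
    -- With `h` = 1/7, the chain reads 2 = 1 + 6h + 7h² ≤ 1 + 6h + 9h² = (1 + 3h)².
    2≤[1+r]² = begin
      fromℕ 2
        ≡⟨ cong (1# +_) (trans fromℕ-1 (sym 7h≡1)) ⟩
      1# + fromℕ 7 * h
        ≡⟨ solve 1 (λ h → con 1 :+ nat 7 :* h := con 1 :+ nat 6 :* h :+ con 1 :* h) refl h ⟩
      1# + fromℕ 6 * h + 1# * h
        ≡⟨ cong (λ z → 1# + fromℕ 6 * h + z * h) 7h≡1 ⟨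
      1# + fromℕ 6 * h + fromℕ 7 * h * h
        ≤⟨ +-monoʳ-≤ _ (*-monoʳ-≤ (proj₁ 0<h) (*-monoʳ-≤ (proj₁ 0<h) (fromℕ-mono (ℕ.m≤n+m 7 2)))) ⟩
      1# + fromℕ 6 * h + fromℕ 9 * h * h
        ≡⟨ solve 1 (λ h → con 1 :+ nat 6 :* h :+ nat 9 :* h :* h :=
             (con 1 :+ nat 3 :* h) :* ((con 1 :+ nat 3 :* h) :* con 1)) refl h ⟩
      (1# + r) ^ 2 ∎

    2nr≤x : fromℕ (2 ℕ.* n) * r ≤ x
    2nr≤x = *-cancelˡ-≤ 0<7 (begin
      fromℕ 7 * (fromℕ (2 ℕ.* n) * r)
        ≡⟨ cong (λ z → fromℕ 7 * (z * r)) (fromℕ-* 2 n) ⟩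
      fromℕ 7 * (fromℕ 2 * fromℕ n * r)
        ≡⟨ solve 2 (λ n h → nat 7 :* (nat 2 :* n :* (nat 3 :* h)) := nat 6 :* n :* (nat 7 :* h))
             refl (fromℕ n) h ⟩
      fromℕ 6 * fromℕ n * (fromℕ 7 * h)
        ≡⟨ trans (cong (fromℕ 6 * fromℕ n *_) 7h≡1) (*-identityʳ _) ⟩
      fromℕ 6 * fromℕ n
        ≤⟨ 6n≤7x ⟩
      fromℕ 7 * x ∎)

  -- The logarithm of numbers that are at least e.

  module _ (e≤x : exp 1# ≤ x) where

    private
      Exponents : ℝ → Set
      Exponents y = exp y ≤ x

      0≤x : 0# ≤ x
      0≤x = ≤-trans (exp-nonneg 0≤1) e≤x

      exponent≤x : IsUpperBound _≤_ Exponents x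
      exponent≤x y exp-y≤x with total y 0#
      ... | inj₁ y≤0 = ≤-trans y≤0 0≤x
      ... | inj₂ 0≤y = ≤-trans (≤-trans (x≤y+x y 0≤1) (1+x≤exp 0≤y)) exp-y≤x

    ≤-log : exp y ≤ x → y ≤ log x
    ≤-log = sup-upper Exponents (1# , e≤x) (x , exponent≤x) _

    -- The set defining `log x` may contain negative exponents. These lie below `u` because
    -- `0# ≤ u`, so `exp` is examined at nonnegative arguments alone.
    log-least : 0# ≤ u → (∀ {y} → 0# ≤ y → exp y ≤ x → y ≤ u) → log x ≤ u
    log-least 0≤u y≤u = sup-least Exponents (1# , e≤x) _ λ y exp-y≤x →
      [ (λ y≤0 → ≤-trans y≤0 0≤u) , (λ 0≤y → y≤u 0≤y exp-y≤x) ]′ (total y 0#)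

    1≤log : 1# ≤ log x
    1≤log = ≤-log e≤x

    0≤log : 0# ≤ log x
    0≤log = ≤-trans 0≤1 1≤log

    x≤e*exp-log : x ≤ exp 1# * exp (log x)
    x≤e*exp-log = ≤-trans x≤exp[1+log] (≤-reflexive (exp-+ 0≤1 0≤log))
      where
      x≤exp[1+log] : x ≤ exp (1# + log x)
      x≤exp[1+log] with total x (exp (1# + log x))
      ... | inj₁ x≤ = x≤
      ... | inj₂ ≤x = contradiction (+-cancelˡ-≤ (log x) (begin
        log x + 1#  ≡⟨ +-comm (log x) 1# ⟩
        1# + log x  ≤⟨ ≤-log ≤x ⟩
        log x       ≡⟨ +-identityʳ (log x) ⟨
        log x + 0#  ∎)) 1≰0

    -- An exponent `y` with `0# ≤ y` satisfies y² ≤ 2 e^y ≤ 2x, which is at most (zx)² as soon as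
    -- z²x ≥ 2.
    log-≤-linear : 0# < z → fromℕ 2 ≤ z * z * x → log x ≤ z * x
    log-≤-linear {z} 0<z 2≤zzx = log-least (proj₁ 0<zx) λ {y} 0≤y exp-y≤x →
      square-cancel-≤ 0<zx (begin
        y * y              ≤⟨ x²≤2exp 0≤y ⟩
        fromℕ 2 * exp y    ≤⟨ *-mono-≤ (0≤fromℕ 2) (exp-nonneg 0≤y) 2≤zzx exp-y≤x ⟩
        z * z * x * x      ≡⟨ solve 2 (λ z x → z :* z :* x :* x := z :* x :* (z :* x)) refl z x ⟩
        z * x * (z * x)    ∎)
      where
      0<zx : 0# < z * x
      0<zx = *-positive 0<z (1≤⇒0< (≤-trans (1≤exp 0≤1) e≤x))

-- The partition into residue classes and the list of all subsets of its blocks.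

module Blocks where
  -- For c ≤ m, the elements v of Fin n with v ≡ c modulo m + 1.
  block : ∀ m n → ℕ → Subset n
  block m zero    c       = []
  block m (suc n) zero    = inside ∷ block m n m
  block m (suc n) (suc c) = outside ∷ block m n c

  -- The last of q elements is c + (q - 1)(m + 1), which is at most n - 1; an empty block uses
  -- `c ≤ m`. Keeping `c` in the bound lets the induction follow the countdown in `block`.
  ∣block∣-bound : ∀ m n c → c ℕ.≤ m → ∣ block m n c ∣ ℕ.* suc m ℕ.+ c ℕ.≤ n ℕ.+ m
  ∣block∣-bound m zero    c       c≤m = c≤m
  ∣block∣-bound m (suc n) zero    c≤m = begin
    suc m ℕ.+ q ℕ.* suc m ℕ.+ 0   ≡⟨ ℕ.+-identityʳ _ ⟩
    suc m ℕ.+ q ℕ.* suc m         ≤⟨ ℕ.+-monoʳ-≤ (suc m) (ℕ.+-cancelʳ-≤ m _ n (∣block∣-bound m n m ℕ.≤-refl)) ⟩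
    suc m ℕ.+ n                   ≡⟨ cong suc (ℕ.+-comm m n) ⟩
    suc n ℕ.+ m                   ∎
    where
    open ℕ.≤-Reasoning
    q = ∣ block m n m ∣
  ∣block∣-bound m (suc n) (suc c) c<m = begin
    ∣ block m n c ∣ ℕ.* suc m ℕ.+ suc c    ≡⟨ ℕ.+-suc _ c ⟩
    suc (∣ block m n c ∣ ℕ.* suc m ℕ.+ c)  ≤⟨ ℕ.s≤s (∣block∣-bound m n c (ℕ.<⇒≤ c<m)) ⟩
    suc n ℕ.+ m                            ∎
    where open ℕ.≤-Reasoning

  ∣block∣≤1+n/[1+m] : ∀ m n c → c ℕ.≤ m → ∣ block m n c ∣ ℕ.≤ suc (n ℕ./ suc m)
  ∣block∣≤1+n/[1+m] m n c c≤m = begin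
    q                             ≡⟨ ℕ.m*n/n≡m q (suc m) ⟨
    q ℕ.* suc m ℕ./ suc m         ≤⟨ ℕ./-monoˡ-≤ (suc m) (begin
      q ℕ.* suc m                   ≤⟨ ℕ.m≤m+n _ c ⟩
      q ℕ.* suc m ℕ.+ c             ≤⟨ ∣block∣-bound m n c c≤m ⟩
      n ℕ.+ m                       ≤⟨ ℕ.+-monoʳ-≤ n (ℕ.n≤1+n m) ⟩
      n ℕ.+ suc m                   ≡⟨ ℕ.+-comm n (suc m) ⟩
      suc m ℕ.+ n                   ∎) ⟩
    (suc m ℕ.+ n) ℕ./ suc m       ≡⟨ ℕ.+-distrib-/-∣ˡ n {suc m} ℕ.∣-refl ⟩
    suc m ℕ./ suc m ℕ.+ n ℕ./ suc m ≡⟨ cong (ℕ._+ n ℕ./ suc m) (ℕ.n/n≡1 (suc m)) ⟩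
    suc (n ℕ./ suc m)             ∎
    where
    open ℕ.≤-Reasoning
    q = ∣ block m n c ∣

  subsetsOf : ∀ {n} → Subset n → List (Subset n)
  subsetsOf []            = [] ∷ []
  subsetsOf (outside ∷ p) = map (outside ∷_) (subsetsOf p)
  subsetsOf (inside ∷ p)  = map (inside ∷_) (subsetsOf p) ++ map (outside ∷_) (subsetsOf p)

  ∩-∈-subsetsOf : ∀ {n} (X p : Subset n) → X ∩ p ∈ subsetsOf p
  ∩-∈-subsetsOf []            []            = here refl
  ∩-∈-subsetsOf (outside ∷ X) (outside ∷ p) = ∈-map⁺ (outside ∷_) (∩-∈-subsetsOf X p)
  ∩-∈-subsetsOf (inside ∷ X)  (outside ∷ p) = ∈-map⁺ (outside ∷_) (∩-∈-subsetsOf X p)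
  ∩-∈-subsetsOf (inside ∷ X)  (inside ∷ p)  = ∈-++⁺ˡ (∈-map⁺ (inside ∷_) (∩-∈-subsetsOf X p))
  ∩-∈-subsetsOf (outside ∷ X) (inside ∷ p)  = ∈-++⁺ʳ _ (∈-map⁺ (outside ∷_) (∩-∈-subsetsOf X p))

  length-subsetsOf : ∀ {n} (p : Subset n) → length (subsetsOf p) ≡ 2 ℕ.^ ∣ p ∣
  length-subsetsOf []            = refl
  length-subsetsOf (outside ∷ p) = trans (length-map (outside ∷_) (subsetsOf p)) (length-subsetsOf p)
  length-subsetsOf (inside ∷ p)  = begin
    length (map (inside ∷_) Ys ++ map (outside ∷_) Ys)
      ≡⟨ length-++ (map (inside ∷_) Ys) ⟩
    length (map (inside ∷_) Ys) ℕ.+ length (map (outside ∷_) Ys)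
      ≡⟨ cong₂ ℕ._+_ (size (inside ∷_)) (trans (size (outside ∷_)) (sym (ℕ.+-identityʳ _))) ⟩
    2 ℕ.^ suc ∣ p ∣ ∎
    where
    open ≡-Reasoning
    Ys = subsetsOf p
    size : (f : Subset _ → Subset _) → length (map f Ys) ≡ 2 ℕ.^ ∣ p ∣
    size f = trans (length-map f Ys) (length-subsetsOf p)

  length-concat-applyUpTo : ∀ {A : Set} {B} (f : ℕ → List A) k → (∀ {c} → c ℕ.< k → length (f c) ℕ.≤ B) →
                            length (concat (applyUpTo f k)) ℕ.≤ k ℕ.* B
  length-concat-applyUpTo f zero    f≤B = ℕ.z≤n
  length-concat-applyUpTo f (suc k) f≤B = ℕ.≤-trans
    (ℕ.≤-reflexive (length-++ (f 0)))
    (ℕ.+-mono-≤ (f≤B (ℕ.s≤s ℕ.z≤n)) (length-concat-applyUpTo (f ∘ suc) k (f≤B ∘ ℕ.s≤s)))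

  candidates : ∀ m n → List (Subset n)
  candidates m n = concat (applyUpTo (subsetsOf ∘ block m n) (suc m))

  ∩-block-∈-candidates : ∀ {m n} (X : Subset n) {c} → c ℕ.< suc m → X ∩ block m n c ∈ candidates m n
  ∩-block-∈-candidates {m} {n} X {c} c<1+m =
    ∈-concat⁺′ (∩-∈-subsetsOf X (block m n c)) (∈-applyUpTo⁺ (subsetsOf ∘ block m n) c<1+m)

  length-candidates : ∀ m n → length (candidates m n) ℕ.≤ suc m ℕ.* 2 ℕ.^ suc (n ℕ./ suc m)
  length-candidates m n = length-concat-applyUpTo (subsetsOf ∘ block m n) (suc m) λ {c} c<1+m →
    ℕ.≤-trans (ℕ.≤-reflexive (length-subsetsOf (block m n c)))
      (ℕ.^-monoʳ-≤ 2 (∣block∣≤1+n/[1+m] m n c (ℕ.s≤s⁻¹ c<1+m)))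

-- The algorithm, its number of queries and its approximation ratio.

module BlockSearch (R : RealNumbers) where
  open RealAnalysis R
  open OrderedField R
  open Convolution R
  open XOSMaximization R
  open Blocks

  -- The right-hand side of `Additive` with the singleton values abstracted to `w`, so that an
  -- induction on the ground set can replace `w` by `w ∘ suc`.
  weight : ∀ {n} → (Fin n → ℝ) → Subset n → ℝ
  weight w X = sum (λ v → if does (v ∈? X) then w v else 0#)

  weight-⊥ : ∀ {n} (w : Fin n → ℝ) → weight w ⊥ ≡ 0#
  weight-⊥ {zero}  w = refl
  weight-⊥ {suc n} w = trans (+-identityˡ _) (weight-⊥ (w ∘ suc))

  -- The blocks partition the ground set. Removing the first element rotates them: block 0 becomes
  -- block `m` of the rest, and block `suc c` becomes block `c`. `Σ<-last` undoes the rotation.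
  Σ<-weight-block : ∀ m {n} (w : Fin n → ℝ) (X : Subset n) →
                    Σ< (λ c → weight w (X ∩ block m n c)) (suc m) ≡ weight w X
  Σ<-weight-block m w [] = sum-replicate-zero (suc m)
  Σ<-weight-block m {suc n} w (s ∷ X) = begin-equality
    F 0 + Σ< (F ∘ suc) m         ≡⟨ cong₂ _+_ (F-zero s) (Σ<-cong (F-suc s) m) ⟩
    w₀ s + G m + Σ< G m          ≡⟨ +-assoc (w₀ s) (G m) (Σ< G m) ⟩
    w₀ s + (G m + Σ< G m)        ≡⟨ cong (w₀ s +_) (Σ<-last G m) ⟨
    w₀ s + Σ< G (suc m)          ≡⟨ cong (w₀ s +_) (Σ<-weight-block m (w ∘ suc) X) ⟩
    w₀ s + weight (w ∘ suc) X    ≡⟨ weight-∷ s ⟨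
    weight w (s ∷ X)             ∎
    where
    w₀ : Bool → ℝ
    w₀ s = if s then w zero else 0#

    F G : ℕ → ℝ
    F c = weight w ((s ∷ X) ∩ block m (suc n) c)
    G c = weight (w ∘ suc) (X ∩ block m n c)

    weight-∷ : ∀ s → weight w (s ∷ X) ≡ w₀ s + weight (w ∘ suc) X
    weight-∷ true  = refl
    weight-∷ false = refl

    F-zero : ∀ s → weight w ((s ∷ X) ∩ block m (suc n) 0) ≡ w₀ s + G m
    F-zero true  = refl
    F-zero false = refl

    F-suc : ∀ s c → weight w ((s ∷ X) ∩ block m (suc n) (suc c)) ≡ G c
    F-suc true  c = +-identityˡ (G c)
    F-suc false c = +-identityˡ (G c)

  -- `B` is the best set so far and `b` its value, carried along so that it is not queried again.
  -- Without `sample` nodes the search is deterministic, and its expected value is the value of the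
  -- returned set.
  search : ∀ {n} → List (Subset n) → Subset n → ℝ → Algorithm n
  search []       B b = return B
  search (X ∷ Xs) B b = query X λ x →
    [ (λ _ → search Xs X x) , (λ _ → search Xs B b) ]′ (total b x)

  queries-search : ∀ {n} (Xs : List (Subset n)) B b f → queries (search Xs B b) f ≡ length Xs
  queries-search []       B b f = refl
  queries-search (X ∷ Xs) B b f with total b (f X)
  ... | inj₁ _ = cong suc (queries-search Xs X (f X) f)
  ... | inj₂ _ = cong suc (queries-search Xs B b f)

  start≤search : ∀ {n} (Xs : List (Subset n)) B b f → f B ≡ b → b ≤ expectedValue (search Xs B b) f
  start≤search []       B b f fB≡b = ≤-reflexive (sym fB≡b)
  start≤search (X ∷ Xs) B b f fB≡b with total b (f X)
  ... | inj₁ b≤fX = ≤-trans b≤fX (start≤search Xs X (f X) f refl)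
  ... | inj₂ _    = start≤search Xs B b f fB≡b

  candidate≤search : ∀ {n} (Xs : List (Subset n)) B b f {X} → f B ≡ b → X ∈ Xs →
                     f X ≤ expectedValue (search Xs B b) f
  candidate≤search (X ∷ Xs) B b f fB≡b X∈Xs with total b (f X) | X∈Xs
  ... | inj₁ _    | here refl = start≤search Xs X (f X) f refl
  ... | inj₁ _    | there X∈  = candidate≤search Xs X (f X) f refl X∈
  ... | inj₂ fX≤b | here refl = ≤-trans fX≤b (start≤search Xs B b f fB≡b)
  ... | inj₂ _    | there X∈  = candidate≤search Xs B b f fB≡b X∈

  -- The starting value 0 costs no query, since an XOS function vanishes on the empty set by
  -- `XOS-⊥`.
  blockSearch : ∀ m n → Algorithm n
  blockSearch m n = search (candidates m n) ⊥ 0#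

  queries-blockSearch : ∀ m n f → queries (blockSearch m n) f ℕ.≤ suc m ℕ.* 2 ℕ.^ suc (n ℕ./ suc m)
  queries-blockSearch m n f =
    ℕ.≤-trans (ℕ.≤-reflexive (queries-search (candidates m n) ⊥ 0# f)) (length-candidates m n)

  XOS-⊥ : ∀ {n} {f : SetFunction n} → XOS f → f ⊥ ≡ 0#
  XOS-⊥ (_ , g , additive , maximum) with proj₂ (maximum ⊥)
  ... | i , gi⊥≡f⊥ = trans (sym gi⊥≡f⊥) (trans (additive i ⊥) (weight-⊥ (λ v → g i ⁅ v ⁆)))

  sum-const : ∀ n x → sum {n} (λ _ → x) ≡ fromℕ n * x
  sum-const n x = begin-equality
    sum {n} (λ _ → x)  ≡⟨ sum-replicate n ⟩
    n · x              ≡⟨ cong (n ·_) (*-identityˡ x) ⟨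
    n · (1# * x)       ≡⟨ ×-assoc-* n 1# x ⟨
    fromℕ n * x        ∎

  maximum≤blocks*blockSearch : ∀ m {n} {f : SetFunction n} → XOS f → ∀ X →
                               f X ≤ fromℕ (suc m) * expectedValue (blockSearch m n) f
  maximum≤blocks*blockSearch m {n} {f} xos@(_ , g , additive , maximum) X with proj₂ (maximum X)
  ... | i , giX≡fX = begin
    f X                                             ≡⟨ giX≡fX ⟨
    g i X                                           ≡⟨ additive i X ⟩
    weight w X                                      ≡⟨ Σ<-weight-block m w X ⟨
    Σ< (λ c → weight w (X ∩ block m n c)) (suc m)   ≤⟨ sum-mono-≤ {suc m} (λ c → begin
      weight w (X ∩ block m n (toℕ c))                ≡⟨ additive i _ ⟨
      g i (X ∩ block m n (toℕ c))                     ≤⟨ proj₁ (maximum _) i ⟩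
      f (X ∩ block m n (toℕ c))                       ≤⟨ candidate≤search (candidates m n) ⊥ 0# f (XOS-⊥ xos)
                                                           (∩-block-∈-candidates X (toℕ<n c)) ⟩
      best                                            ∎) ⟩
    sum {suc m} (λ _ → best)                        ≡⟨ sum-const (suc m) best ⟩
    fromℕ (suc m) * best                            ∎
    where
    w = λ v → g i ⁅ v ⁆
    best = expectedValue (blockSearch m n) f

  blockSearch-isApproximation : ∀ {α m n} → 1# ≤ α → fromℕ (suc m) ≤ α →
                                IsApproximation α (blockSearch m n)
  blockSearch-isApproximation {α} {m} {n} 1≤α 1+m≤α f xos M (_ , X , fX≡M) = *-cancelˡ-≤ 0<α (begin
    α * (1# / α * M)      ≡⟨ solve 3 (λ α β M → α :* (con 1 :* β :* M) := α :* β :* M) refl α (α ⁻¹) M ⟩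
    α * α ⁻¹ * M          ≡⟨ cong (_* M) (⁻¹-inverse α (<⇒≢0 0<α)) ⟩
    1# * M                ≡⟨ *-identityˡ M ⟩
    M                     ≡⟨ fX≡M ⟨
    f X                   ≤⟨ maximum≤blocks*blockSearch m xos X ⟩
    fromℕ (suc m) * best  ≤⟨ *-monoʳ-≤ (start≤search (candidates m n) ⊥ 0# f (XOS-⊥ xos)) 1+m≤α ⟩
    α * best              ∎)
    where
    0<α = 1≤⇒0< 1≤α
    best = expectedValue (blockSearch m n) f

module RunningTime (em : ExcludedMiddle 0ℓ) (R : RealNumbers) where
  open RealAnalysis R
  open OrderedField R
  open Exponential em R

  -- Here x = n, b is the number of blocks and 1 + D bounds their sizes.
  blocks*2^size-bound : ∀ {ε x} b D → 0# < ε → exp 1# ≤ x → fromℕ 7 * log x ≤ ε * x →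
    fromℕ b ≤ ε * x / log x → ε * x / log x ≤ fromℕ (suc b) → fromℕ (D ℕ.* b) ≤ x →
    fromℕ (b ℕ.* 2 ℕ.^ suc D) ≤
      fromℕ 2 * ε * exp 1# * (exp ((1# / ε + 1#) * log x) * log x)
  blocks*2^size-bound {ε} {x} b D 0<ε e≤x 7L≤εx b≤r r≤1+b Db≤x = begin
    fromℕ (b ℕ.* 2 ℕ.^ suc D)
      ≡⟨ trans (fromℕ-* b (2 ℕ.^ suc D)) (cong (b̂ *_) (fromℕ-^ 2 (suc D))) ⟩
    b̂ * (fromℕ 2 * fromℕ 2 ^ D)
      ≤⟨ *-mono-≤ (0≤fromℕ b) (*-nonneg (0≤fromℕ 2) (^-nonneg (0≤fromℕ 2) D))
           b̂≤ (*-monoˡ-≤ (0≤fromℕ 2) (2^n≤exp D 6D≤7y)) ⟩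
    ε * (exp 1# * exp L) * L * (fromℕ 2 * exp y)
      ≡⟨ solve 6 (λ ε e E L t Y → ε :* (e :* E) :* L :* (t :* Y) := t :* ε :* e :* (Y :* E :* L))
           refl ε (exp 1#) (exp L) L (fromℕ 2) (exp y) ⟩
    fromℕ 2 * ε * exp 1# * (exp y * exp L * L)
      ≡⟨ cong (λ z → fromℕ 2 * ε * exp 1# * (z * L)) exp-y*exp-L ⟩
    fromℕ 2 * ε * exp 1# * (exp ((1# / ε + 1#) * L) * L) ∎
    where
    L = log x
    1≤L = 1≤log e≤x
    0<L = 1≤⇒0< 1≤L
    0≤L = proj₁ 0<L
    b̂ = fromℕ b
    r = ε * x / L
    y = 1# / ε * L

    0≤y : 0# ≤ y
    0≤y = *-nonneg (*-nonneg 0≤1 (proj₁ (⁻¹-positive 0<ε))) 0≤L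

    exp-y*exp-L : exp y * exp L ≡ exp ((1# / ε + 1#) * L)
    exp-y*exp-L = trans (sym (exp-+ 0≤y 0≤L))
      (cong exp (solve 2 (λ q L → q :* L :+ L := (q :+ con 1) :* L) refl (1# / ε) L))

    y*r≡x : y * r ≡ x
    y*r≡x = begin-equality
      1# * ε ⁻¹ * L * (ε * x * L ⁻¹)
        ≡⟨ solve 5 (λ ε ε⁻¹ L L⁻¹ x → con 1 :* ε⁻¹ :* L :* (ε :* x :* L⁻¹) :=
             ε :* ε⁻¹ :* (L :* L⁻¹) :* x) refl ε (ε ⁻¹) L (L ⁻¹) x ⟩
      ε * ε ⁻¹ * (L * L ⁻¹) * x
        ≡⟨ cong₂ (λ p q → p * q * x) (⁻¹-inverse ε (<⇒≢0 0<ε)) (⁻¹-inverse L (<⇒≢0 0<L)) ⟩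
      1# * 1# * x
        ≡⟨ solve 1 (λ x → con 1 :* con 1 :* x := x) refl x ⟩
      x ∎

    6≤b : fromℕ 6 ≤ b̂
    6≤b = +-cancelˡ-≤ 1# (begin
      fromℕ 7          ≤⟨ ≤-/ 0<L (≤-trans (≤-reflexive (*-comm L (fromℕ 7))) 7L≤εx) ⟩
      r                ≤⟨ r≤1+b ⟩
      1# + b̂           ∎)

    6D≤7y : fromℕ 6 * fromℕ D ≤ fromℕ 7 * y
    6D≤7y = *-cancelˡ-≤ (<-≤-trans 0<1 (x≤x+y 1# (0≤fromℕ b))) (begin
      (1# + b̂) * (fromℕ 6 * fromℕ D)
        ≡⟨ solve 2 (λ b D → (con 1 :+ b) :* (nat 6 :* D) := D :* (nat 6 :+ nat 6 :* b)) refl b̂ (fromℕ D) ⟩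
      fromℕ D * (fromℕ 6 + fromℕ 6 * b̂)
        ≤⟨ *-monoˡ-≤ (0≤fromℕ D) (+-mono-≤ 6≤b ≤-refl) ⟩
      fromℕ D * (b̂ + fromℕ 6 * b̂)
        ≡⟨ solve 2 (λ b D → D :* (b :+ nat 6 :* b) := nat 7 :* (D :* b)) refl b̂ (fromℕ D) ⟩
      fromℕ 7 * (fromℕ D * b̂)
        ≤⟨ *-monoˡ-≤ (0≤fromℕ 7) (≤-trans (≤-reflexive (sym (fromℕ-* D b))) Db≤x) ⟩
      fromℕ 7 * x
        ≡⟨ cong (fromℕ 7 *_) y*r≡x ⟨
      fromℕ 7 * (y * r)
        ≤⟨ *-monoˡ-≤ (0≤fromℕ 7) (*-monoˡ-≤ 0≤y r≤1+b) ⟩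
      fromℕ 7 * (y * (1# + b̂))
        ≡⟨ solve 2 (λ b y → nat 7 :* (y :* (con 1 :+ b)) := (con 1 :+ b) :* (nat 7 :* y)) refl b̂ y ⟩
      (1# + b̂) * (fromℕ 7 * y) ∎)

    ≤-*L : ∀ {z} → 0# ≤ z → z ≤ z * L
    ≤-*L 0≤z = ≤-trans (≤-reflexive (sym (*-identityʳ _))) (*-monoˡ-≤ 0≤z 1≤L)

    b̂≤ : b̂ ≤ ε * (exp 1# * exp L) * L
    b̂≤ = begin
      b̂                           ≤⟨ b≤r ⟩
      r                           ≤⟨ ≤-*L (≤-trans (0≤fromℕ b) b≤r) ⟩
      r * L                       ≡⟨ *-⁻¹-cancelʳ 0<L (ε * x) ⟩
      ε * x                       ≤⟨ *-monoˡ-≤ (proj₁ 0<ε) (x≤e*exp-log e≤x) ⟩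
      ε * (exp 1# * exp L)        ≤⟨ ≤-*L (*-nonneg (proj₁ 0<ε) (*-nonneg (exp-nonneg 0≤1) (exp-nonneg 0≤L))) ⟩
      ε * (exp 1# * exp L) * L    ∎

theorem2 : ExcludedMiddle 0ℓ → (R : RealNumbers) →
    let open RealAnalysis R
        open XOSMaximization R
        ratio : ℝ → ℕ → ℝ
        ratio ε n = (ε * fromℕ n) / log (fromℕ n)
    in
    ∀ (ε : ℝ) → 0# < ε →
    Σ[ A ∈ (∀ n → Algorithm n) ]
      (∀ n → 2 ℕ.≤ n → 1# ≤ ratio ε n → IsApproximation (ratio ε n) (A n)) ×
      RunsInO A (λ n → fromℕ n ^ʳ (1# / ε + 1#) * log (fromℕ n))
theorem2 em R ε 0<ε =
  (λ n → blockSearch (m n) n) ,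
  (λ n _ 1≤r → blockSearch-isApproximation 1≤r (proj₁ (floor-ratio n) 1≤r)) ,
  fromℕ 2 * ε * exp 1# , n₀ , runningTime
  where
  open RealAnalysis R
  open XOSMaximization R
  open OrderedField R
  open Completeness em R
  open Exponential em R
  open BlockSearch R
  open RunningTime em R

  ratio : ℕ → ℝ
  ratio n = (ε * fromℕ n) / log (fromℕ n)

  m : ℕ → ℕ
  m n = proj₁ (floor (ratio n))

  floor-ratio : ∀ n → (1# ≤ ratio n → fromℕ (suc (m n)) ≤ ratio n) × ratio n ≤ fromℕ (2 ℕ.+ m n)
  floor-ratio n = proj₂ (floor (ratio n))

  0<7 : 0# < fromℕ 7
  0<7 = fromℕ-positive {7} (ℕ.s≤s ℕ.z≤n)

  δ : ℝ
  δ = ε / fromℕ 7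

  0<δ : 0# < δ
  0<δ = *-positive 0<ε (⁻¹-positive 0<7)

  n₁ n₂ n₀ : ℕ
  n₁ = proj₁ (archimedean (exp 1#))
  n₂ = proj₁ (archimedean (fromℕ 2 / (δ * δ)))
  n₀ = n₁ ℕ.+ n₂

  runningTime : ∀ n → n₀ ℕ.≤ n → ∀ (f : SetFunction n) → XOS f →
    fromℕ (queries (blockSearch (m n) n) f) ≤
      fromℕ 2 * ε * exp 1# * (fromℕ n ^ʳ (1# / ε + 1#) * log (fromℕ n))
  runningTime n n₀≤n f _ = ≤-trans (fromℕ-mono (queries-blockSearch (m n) n f))
    (blocks*2^size-bound (suc (m n)) (n ℕ./ suc (m n)) 0<ε e≤n 7L≤εn
      (proj₁ (floor-ratio n) 1≤ratio) (proj₂ (floor-ratio n))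
      (fromℕ-mono (ℕ.m/n*n≤m n (suc (m n)))))
    where
    L = log (fromℕ n)

    e≤n : exp 1# ≤ fromℕ n
    e≤n = ≤-trans (proj₂ (archimedean (exp 1#)))
      (fromℕ-mono (ℕ.≤-trans (ℕ.m≤m+n n₁ n₂) n₀≤n))

    2≤δδn : fromℕ 2 ≤ δ * δ * fromℕ n
    2≤δδn = begin
      fromℕ 2                      ≡⟨ *-⁻¹-cancelʳ (*-positive 0<δ 0<δ) (fromℕ 2) ⟨
      fromℕ 2 / (δ * δ) * (δ * δ)  ≡⟨ *-comm _ (δ * δ) ⟩
      δ * δ * (fromℕ 2 / (δ * δ))  ≤⟨ *-monoˡ-≤ (proj₁ (*-positive 0<δ 0<δ))
                                        (≤-trans (proj₂ (archimedean (fromℕ 2 / (δ * δ))))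
                                          (fromℕ-mono (ℕ.≤-trans (ℕ.m≤n+m n₂ n₁) n₀≤n))) ⟩
      δ * δ * fromℕ n              ∎

    7L≤εn : fromℕ 7 * L ≤ ε * fromℕ n
    7L≤εn = begin
      fromℕ 7 * L              ≤⟨ *-monoˡ-≤ (0≤fromℕ 7) (log-≤-linear e≤n 0<δ 2≤δδn) ⟩
      fromℕ 7 * (δ * fromℕ n)  ≡⟨ *-assoc (fromℕ 7) δ (fromℕ n) ⟨
      fromℕ 7 * δ * fromℕ n    ≡⟨ cong (_* fromℕ n) (trans (*-comm (fromℕ 7) δ) (*-⁻¹-cancelʳ 0<7 ε)) ⟩
      ε * fromℕ n              ∎

    1≤ratio : 1# ≤ ratio n
    1≤ratio = ≤-/ (1≤⇒0< (1≤log e≤n)) (begin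
      L * 1#       ≤⟨ *-monoˡ-≤ (0≤log e≤n) (1≤fromℕ {7} (ℕ.s≤s ℕ.z≤n)) ⟩
      L * fromℕ 7  ≡⟨ *-comm L (fromℕ 7) ⟩
      fromℕ 7 * L  ≤⟨ 7L≤εn ⟩
      ε * fromℕ n  ∎)
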